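{- For every integer $d\geqslant 1$ there exists a finite kei $K=(X,\triangleright)$ such that the edge-coloured multigraph $G_K$ has a connected component, with vertex set $C\subseteq X$, for which $G_K[C]$ has diameter $d$, $|C|=2^d$, and the maximum over all colours $k\in X$ of the number of edges of colour $k$ in $G_K[C]$ is exactly $2^{d-1}$.
   Context: A kei is a pair $(X,\triangleright)$ with $X$ a non-empty set and $\triangleright:X\times X\to X$ a binary operation such that: for each $y\in X$ the map $x\mapsto x\triangleright y$ is a bijection on $X$; $(x\triangleright y)\triangleright z=(x\triangleright z)\triangleright(y\triangleright z)$ for all $x,y,z\in X$; $x\triangleright x=x$ for all $x\in X$; and $(x\triangleright y)\triangleright y=x$ for all $x,y\in X$. For $y\in X$ write $f_y:X\to X$ for the involution $(x)f_y=x\triangleright y$ (maps act on the right). For a kei $K=(X,\triangleright)$, $G_K$ is the loopless edge-coloured multigraph with vertex set $X$ and colour set $X$, in which, for each $y\in X$, there is exactly one edge of colour $y$ between $u$ and $v$ if and only if $u\neq v$ and $(u)f_y=v$. Edges of different colours between the same two vertices are different edges. Diameter refers to the usual graph distance, ignoring colours and multiplicities. -}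

module Defs where

open import Algebra.Core using (Op₂)
import Algebra.Definitions as AlgebraDefinitions
open import Data.Fin.Base using (Fin)
open import Data.Nat.Base using (ℕ; zero; suc; _≤_)
open import Data.Product.Base using (Σ; ∃-syntax; _×_; _,_; proj₁; proj₂; swap)
open import Data.Refinement using (Refinement; value)
  renaming (_,_ to _,ʳ_)
import Data.Irrelevant as Irrelevant
open import Data.Sum.Base using (_⊎_; inj₁; inj₂)
open import Function.Base using (_∘_)
open import Function.Bundles using (Inverse)
open import Function.Definitions using (Bijective)
open import Level using (0ℓ)
open import Relation.Binary.Bundles using (Setoid)
open import Relation.Binary.Core using (Rel)
import Relation.Binary.Construct.On as On
open import Relation.Binary.PropositionalEquality
  using (_≡_; _≢_; refl; sym; trans; cong; setoid)
open import Relation.Unary using (Pred; _∈_; _≐_)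

record Kei : Set₁ where
  infixl 7 _▷_
  field
    Carrier : Set
    _▷_     : Op₂ Carrier
  open AlgebraDefinitions {A = Carrier} _≡_
  field
    nonEmpty        : Carrier
    bijective       : ∀ y → Bijective _≡_ _≡_ (_▷ y)
    selfDistributes : _▷_ DistributesOverʳ _▷_
    idempotent      : Idempotent _▷_
    involutive      : ∀ y → Involutive (_▷ y)

infix 4 _HasSize_

_HasSize_ : Setoid 0ℓ 0ℓ → ℕ → Set
S HasSize n = Inverse S (setoid (Fin n))

Finite : Set → Set
Finite A = ∃[ n ] setoid A HasSize n

-- Equality of the unordered pairs represented by two ordered pairs.
infix 4 _≈ᵤ_

_≈ᵤ_ : {A : Set} → Rel (A × A) 0ℓ
p ≈ᵤ q = p ≡ q ⊎ p ≡ swap q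

-- Edges form a setoid, so that an unoriented edge may be represented by
-- either of its two orientations; hence `ends` respects edge equality only
-- up to order.  Distinct edges may share both their ends.
record ColouredMultigraph : Set₁ where
  field
    Vertex Colour : Set
    edges         : Setoid 0ℓ 0ℓ
  open Setoid edges public using () renaming (Carrier to Edge; _≈_ to _≈ₑ_)
  field
    colour      : Edge → Colour
    ends        : Edge → Vertex × Vertex
    colour-cong : ∀ {e e′} → e ≈ₑ e′ → colour e ≡ colour e′
    ends-cong   : ∀ {e e′} → e ≈ₑ e′ → ends e ≈ᵤ ends e′
    loopless    : ∀ e → proj₁ (ends e) ≢ proj₂ (ends e)

  Adjacent : Rel Vertex 0ℓ
  Adjacent u v = ∃[ e ] ends e ≈ᵤ (u , v)

  data Walk : Vertex → Vertex → ℕ → Set where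
    []  : ∀ {u} → Walk u u zero
    _∷_ : ∀ {u v w n} → Adjacent u v → Walk v w n → Walk u w (suc n)

  Connected : Rel Vertex 0ℓ
  Connected u v = ∃[ n ] Walk u v n

  IsComponent : Pred Vertex 0ℓ → Set
  IsComponent C = ∃[ u ] C ≐ Connected u

  Distance : Vertex → Vertex → ℕ → Set
  Distance u v n = Walk u v n × (∀ m → Walk u v m → n ≤ m)

  -- The maximum distance between two vertices is attained and equals d;
  -- in particular the graph is connected.
  HasDiameter : ℕ → Set
  HasDiameter d =
      (∀ u v → ∃[ n ] (Distance u v n × n ≤ d))
    × (∃[ u ] ∃[ v ] Distance u v d)

  edgesOfColour : Colour → Setoid 0ℓ 0ℓ
  edgesOfColour k = On.setoid {B = Σ Edge (λ e → colour e ≡ k)} edges proj₁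

  MaxColourClassSize : ℕ → Set
  MaxColourClassSize M =
      (∀ k → ∃[ m ] (edgesOfColour k HasSize m × m ≤ M))
    × (∃[ k ] edgesOfColour k HasSize M)

-- The induced subgraph G[C].  Membership proofs are irrelevant, so a vertex
-- of G gives at most one vertex of G[C].
induced : (G : ColouredMultigraph) →
          Pred (ColouredMultigraph.Vertex G) 0ℓ → ColouredMultigraph
induced G C = record
  { Vertex      = Refinement G.Vertex C
  ; Colour      = G.Colour
  ; edges       = On.setoid {B = Refinement G.Edge EndsIn} G.edges value
  ; colour      = G.colour ∘ value
  ; ends        = ends
  ; colour-cong = G.colour-cong
  ; ends-cong   = λ {e} {e′} e≈e′ → lift (ends e) (ends e′) (G.ends-cong e≈e′)
  ; loopless    = λ (e ,ʳ _) → G.loopless e ∘ cong value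
  }
  where
  module G = ColouredMultigraph G

  EndsIn : Pred G.Edge 0ℓ
  EndsIn e = proj₁ (G.ends e) ∈ C × proj₂ (G.ends e) ∈ C

  ends : Refinement G.Edge EndsIn → Refinement G.Vertex C × Refinement G.Vertex C
  ends (e ,ʳ p) =
      (proj₁ (G.ends e) ,ʳ Irrelevant.map proj₁ p)
    , (proj₂ (G.ends e) ,ʳ Irrelevant.map proj₂ p)

  values : Refinement G.Vertex C × Refinement G.Vertex C → G.Vertex × G.Vertex
  values (u , v) = value u , value v

  lift : ∀ p q → values p ≈ᵤ values q → p ≈ᵤ q
  lift ((u ,ʳ _) , (v ,ʳ _)) ((.u ,ʳ _) , (.v ,ʳ _)) (inj₁ refl) = inj₁ refl
  lift ((u ,ʳ _) , (v ,ʳ _)) ((.v ,ʳ _) , (.u ,ʳ _)) (inj₂ refl) = inj₂ refl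


module _ (K : Kei) where
  open Kei K

  -- An edge of G_K together with one of its two orientations.
  record Arc : Set where
    field
      colour source target : Carrier
      distinct             : source ≢ target
      moves                : source ▷ colour ≡ target

  open Arc

  arcEnds : Arc → Carrier × Carrier
  arcEnds a = source a , target a

  -- Arcs give the same edge when they agree in colour and unoriented ends.
  SameEdge : Rel Arc 0ℓ
  SameEdge a b = colour a ≡ colour b × arcEnds a ≈ᵤ arcEnds b

  private
    ≈ᵤ-sym : {p q : Carrier × Carrier} → p ≈ᵤ q → q ≈ᵤ p
    ≈ᵤ-sym (inj₁ refl) = inj₁ refl
    ≈ᵤ-sym (inj₂ refl) = inj₂ refl

    ≈ᵤ-trans : {p q r : Carrier × Carrier} → p ≈ᵤ q → q ≈ᵤ r → p ≈ᵤ r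
    ≈ᵤ-trans (inj₁ refl) q≈r         = q≈r
    ≈ᵤ-trans (inj₂ refl) (inj₁ refl) = inj₂ refl
    ≈ᵤ-trans (inj₂ refl) (inj₂ refl) = inj₁ refl

  keiGraph : ColouredMultigraph
  keiGraph = record
    { Vertex      = Carrier
    ; Colour      = Carrier
    ; edges       = record
      { Carrier       = Arc
      ; _≈_           = SameEdge
      ; isEquivalence = record
        { refl  = refl , inj₁ refl
        ; sym   = λ (c , p) → sym c , ≈ᵤ-sym p
        ; trans = λ (c , p) (c′ , p′) → trans c c′ , ≈ᵤ-trans p p′
        }
      }
    ; colour      = colour
    ; ends        = arcEnds
    ; colour-cong = proj₁
    ; ends-cong   = proj₂
    ; loopless    = distinct
    }

{-# OPTIONS --safe #-}

-- Take X to be the vertices of the d-cube together with its d coordinate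
-- directions: a direction acts on vertices by flipping that coordinate, and
-- all other actions are trivial.  Flips are commuting involutions, so this is
-- a kei; the cube is a component, distance in it is Hamming distance, and
-- each direction colours one perfect matching.
module Submission where

open import Defs
open import Data.Bool.Base using (Bool; true; false; not)
open import Data.Bool.Properties using (not-involutive)
open import Data.Empty using (⊥; ⊥-elim)
open import Data.Fin.Base using (Fin; zero; suc)
open import Data.Fin.Properties using (_≟_; +↔⊎; *↔×; 2↔Bool)
import Data.Irrelevant as Irrelevant
open import Data.Nat.Base using (ℕ; zero; suc; _+_; _≤_; z≤n; s≤s; _∸_; _^_)
open import Data.Nat.Properties
  using (≤-refl; ≤-reflexive; ≤-trans; +-mono-≤; +-monoˡ-≤; +-monoʳ-≤; +-suc; suc-injective)
open import Data.Product.Base using (Σ; ∃-syntax; _×_; _,_; proj₁; proj₂; uncurry)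
open import Data.Product.Function.NonDependent.Propositional using (_×-↔_)
open import Data.Refinement using (Refinement; value)
  renaming (_,_ to _,ʳ_)
open import Data.Sum.Base as Sum using (_⊎_; inj₁; inj₂; [_,_])
open import Data.Sum.Function.Propositional using (_⊎-↔_)
open import Data.Sum.Properties using (inj₁-injective)
open import Data.Unit.Base using (⊤; tt)
open import Data.Vec.Base
  using (Vec; []; _∷_; uncons; lookup; updateAt; insertAt; removeAt; replicate)
open import Data.Vec.Properties
  using (updateAt-updateAt-local; updateAt-id; updateAt-commutes; removeAt-insertAt)
open import Function.Base using (_∘_; const)
open import Function.Bundles using (Inverse; _↔_; mk↔ₛ′)
import Function.Construct.Composition as Composition
open import Function.Properties.Inverse using (↔-refl; ↔-sym; ↔-trans)
open import Level using (0ℓ)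
open import Relation.Binary.PropositionalEquality
  using (_≡_; _≢_; refl; sym; trans; cong; cong₂; subst; setoid)
open import Relation.Nullary using (yes; no; contradiction)
open import Relation.Unary using (Pred)

private variable
  n : ℕ

-- Coordinate flips on the Boolean cube.

Cube : ℕ → Set
Cube = Vec Bool

flip : Fin n → Cube n → Cube n
flip i u = updateAt u i not

flip-involutive : ∀ (i : Fin n) u → flip i (flip i u) ≡ u
flip-involutive i u =
  trans (updateAt-updateAt-local i u (not-involutive (lookup u i))) (updateAt-id i u)

flip-commutes : ∀ (i j : Fin n) u → flip i (flip j u) ≡ flip j (flip i u)
flip-commutes i j u with i ≟ j
... | yes refl = refl
... | no  i≢j  = updateAt-commutes i j i≢j u

flip-moves : ∀ (i : Fin n) u → u ≢ flip i u
flip-moves zero    (false ∷ u) ()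
flip-moves zero    (true  ∷ u) ()
flip-moves (suc i) (x ∷ u)     eq = flip-moves i u (cong (proj₂ ∘ uncons) eq)

-- Makes deletion of coordinate `i` well defined on unoriented edges in direction `i`. The index is
-- matched two deep because deletion at a successor position computes only once the tail is visibly
-- nonempty.
removeAt-flip : ∀ (i : Fin (suc n)) u → removeAt (flip i u) i ≡ removeAt u i
removeAt-flip zero          (x ∷ u)         = refl
removeAt-flip (suc zero)    (x ∷ y ∷ u)     = refl
removeAt-flip (suc (suc i)) (x ∷ y ∷ z ∷ u) = cong (x ∷_) (removeAt-flip (suc i) (y ∷ z ∷ u))

-- Of the two ends of an edge in direction `i`, the one with `false` there serves as the canonical
-- representative.
insertAt-false-removeAt : ∀ (i : Fin (suc n)) u →
  insertAt (removeAt u i) i false ≡ u ⊎ insertAt (removeAt u i) i false ≡ flip i u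
insertAt-false-removeAt zero    (false ∷ u)     = inj₁ refl
insertAt-false-removeAt zero    (true  ∷ u)     = inj₂ refl
insertAt-false-removeAt (suc i) (x ∷ u@(_ ∷ _)) =
  Sum.map (cong (x ∷_)) (cong (x ∷_)) (insertAt-false-removeAt i u)

Cube↔Fin : ∀ n → Cube n ↔ Fin (2 ^ n)
Cube↔Fin zero    = mk↔ₛ′ (λ _ → zero) (λ _ → []) (λ { zero → refl }) (λ { [] → refl })
Cube↔Fin (suc n) =
  ↔-trans (mk↔ₛ′ uncons (uncurry _∷_) (λ _ → refl) (λ { (_ ∷ _) → refl }))
    (↔-trans (↔-sym 2↔Bool ×-↔ Cube↔Fin n) (↔-sym *↔×))

-- Hamming distance.

differ : Bool → Bool → ℕ
differ false false = 0
differ false true  = 1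
differ true  false = 1
differ true  true  = 0

hamming : Cube n → Cube n → ℕ
hamming []      []      = 0
hamming (x ∷ u) (y ∷ v) = differ x y + hamming u v

differ≤1 : ∀ x y → differ x y ≤ 1
differ≤1 false false = z≤n
differ≤1 false true  = ≤-refl
differ≤1 true  false = ≤-refl
differ≤1 true  true  = z≤n

hamming≤n : (u v : Cube n) → hamming u v ≤ n
hamming≤n []      []      = z≤n
hamming≤n (x ∷ u) (y ∷ v) = +-mono-≤ (differ≤1 x y) (hamming≤n u v)

hamming-antipodal : ∀ n → hamming (replicate n false) (replicate n true) ≡ n
hamming-antipodal zero    = refl
hamming-antipodal (suc n) = cong suc (hamming-antipodal n)

hamming-refl : (u : Cube n) → hamming u u ≡ 0
hamming-refl []          = refl
hamming-refl (false ∷ u) = hamming-refl u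
hamming-refl (true  ∷ u) = hamming-refl u

hamming≡0⇒≡ : (u v : Cube n) → hamming u v ≡ 0 → u ≡ v
hamming≡0⇒≡ []          []          _  = refl
hamming≡0⇒≡ (false ∷ u) (false ∷ v) eq = cong (false ∷_) (hamming≡0⇒≡ u v eq)
hamming≡0⇒≡ (true  ∷ u) (true  ∷ v) eq = cong (true ∷_) (hamming≡0⇒≡ u v eq)

-- Only the summand at `i` changes, and every summand is at most 1. This is the inductive step of
-- the lower bound on walk lengths.
hamming-flip : ∀ (i : Fin n) u v → hamming u v ≤ suc (hamming (flip i u) v)
hamming-flip zero    (x ∷ u) (y ∷ v) =
  ≤-trans (+-monoˡ-≤ (hamming u v) (differ≤1 x y))
    (s≤s (+-monoˡ-≤ (hamming u v) (z≤n {differ (not x) y})))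
hamming-flip (suc i) (x ∷ u) (y ∷ v) =
  ≤-trans (+-monoʳ-≤ (differ x y) (hamming-flip i u v))
    (≤-reflexive (+-suc (differ x y) _))

-- The witness is the first coordinate in which `u` and `v` disagree. Iterating gives a shortest
-- walk.
hamming-closer : ∀ (u v : Cube n) {k} → hamming u v ≡ suc k →
                 ∃[ i ] hamming (flip i u) v ≡ k
hamming-closer []          []          ()
hamming-closer (false ∷ u) (true  ∷ v) eq = zero , suc-injective eq
hamming-closer (true  ∷ u) (false ∷ v) eq = zero , suc-injective eq
hamming-closer (false ∷ u) (false ∷ v) eq with hamming-closer u v eq
... | i , eq′ = suc i , eq′
hamming-closer (true  ∷ u) (true  ∷ v) eq with hamming-closer u v eq
... | i , eq′ = suc i , eq′

module _ (G : ColouredMultigraph) (C : Pred (ColouredMultigraph.Vertex G) 0ℓ) where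
  private
    module G = ColouredMultigraph G
    module H = ColouredMultigraph (induced G C)

  -- Lets bounds on walks in `G` apply to the induced subgraph, and lets walks built there witness
  -- connectivity in `G`.
  walk-value : ∀ {u v m} → H.Walk u v m → G.Walk (value u) (value v) m
  walk-value H.[]                             = G.[]
  walk-value (((e ,ʳ _) , inj₁ refl) H.∷ w) = (e , inj₁ refl) G.∷ walk-value w
  walk-value (((e ,ʳ _) , inj₂ refl) H.∷ w) = (e , inj₂ refl) G.∷ walk-value w

-- The kei, its cube component and the diameter.

module _ (n : ℕ) where

  infixl 7 _▷_

  _▷_ : Cube n ⊎ Fin n → Cube n ⊎ Fin n → Cube n ⊎ Fin n
  inj₁ u ▷ inj₁ _ = inj₁ u
  inj₁ u ▷ inj₂ i = inj₁ (flip i u)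
  inj₂ j ▷ _      = inj₂ j

  ▷-involutive : ∀ y x → (x ▷ y) ▷ y ≡ x
  ▷-involutive (inj₁ _) (inj₁ _) = refl
  ▷-involutive (inj₂ i) (inj₁ u) = cong inj₁ (flip-involutive i u)
  ▷-involutive _        (inj₂ _) = refl

  -- Acting on `y` never changes how `y` itself acts: directions are fixed, and all cube vertices
  -- act trivially. The only case with content has two directions acting on a vertex, where flips
  -- commute.
  ▷-selfDistributes : ∀ z x y → (x ▷ y) ▷ z ≡ (x ▷ z) ▷ (y ▷ z)
  ▷-selfDistributes (inj₁ _) (inj₁ _) (inj₁ _) = refl
  ▷-selfDistributes (inj₁ _) (inj₁ _) (inj₂ _) = refl
  ▷-selfDistributes (inj₂ _) (inj₁ _) (inj₁ _) = refl
  ▷-selfDistributes (inj₂ i) (inj₁ u) (inj₂ j) = cong inj₁ (flip-commutes i j u)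
  ▷-selfDistributes _        (inj₂ _) _        = refl

  ▷-idempotent : ∀ x → x ▷ x ≡ x
  ▷-idempotent (inj₁ _) = refl
  ▷-idempotent (inj₂ _) = refl

  cubeKei : Kei
  cubeKei = record
    { Carrier         = Cube n ⊎ Fin n
    ; _▷_             = _▷_
    ; nonEmpty        = inj₁ (replicate n false)
    ; bijective       = λ y →
        (λ {x} {x′} eq → trans (sym (▷-involutive y x))
                           (trans (cong (_▷ y) eq) (▷-involutive y x′)))
      , (λ x → x ▷ y , λ { refl → ▷-involutive y x })
    ; selfDistributes = ▷-selfDistributes
    ; idempotent      = ▷-idempotent
    ; involutive      = ▷-involutive
    }

  cubeKei-finite : Finite (Cube n ⊎ Fin n)
  cubeKei-finite = 2 ^ n + n , ↔-trans (Cube↔Fin n ⊎-↔ ↔-refl) (↔-sym +↔⊎)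

  -- Since membership computes to `⊤` or `⊥`, even an irrelevant proof that a direction belongs can
  -- be refuted by an absurd pattern.
  IsVertex : Pred (Cube n ⊎ Fin n) 0ℓ
  IsVertex = [ const ⊤ , const ⊥ ]

  private
    module G = ColouredMultigraph (keiGraph cubeKei)
    module H = ColouredMultigraph (induced (keiGraph cubeKei) IsVertex)

  vertex : Cube n → H.Vertex
  vertex u = inj₁ u ,ʳ Irrelevant.[ tt ]

  Vertex↔Cube : H.Vertex ↔ Cube n
  Vertex↔Cube = mk↔ₛ′ to vertex (λ _ → refl) from∘to
    where
    to : H.Vertex → Cube n
    to (inj₁ u ,ʳ _) = u
    to (inj₂ _ ,ʳ Irrelevant.[ () ])
    from∘to : ∀ x → vertex (to x) ≡ x
    from∘to (inj₁ u ,ʳ _) = refl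
    from∘to (inj₂ _ ,ʳ Irrelevant.[ () ])

  flipArc : Fin n → Cube n → Arc cubeKei
  flipArc i u = record
    { colour   = inj₂ i
    ; source   = inj₁ u
    ; target   = inj₁ (flip i u)
    ; distinct = flip-moves i u ∘ inj₁-injective
    ; moves    = refl
    }

  flipEdge : Fin n → Cube n → H.Edge
  flipEdge i u = flipArc i u ,ʳ Irrelevant.[ tt , tt ]

  -- An edge coloured by a cube vertex, or starting at a direction, would be a loop; only flips
  -- remain.
  adjacent⇒flip : ∀ {u y} → G.Adjacent (inj₁ u) y → ∃[ i ] y ≡ inj₁ (flip i u)
  adjacent⇒flip (record { colour = inj₁ _ ; source = inj₁ _ ; distinct = d ; moves = m } , _) =
    contradiction m d
  adjacent⇒flip (record { source = inj₂ _ ; distinct = d ; moves = m } , _) =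
    contradiction m d
  adjacent⇒flip (record { colour = inj₂ i ; source = inj₁ _ ; moves = refl } , inj₁ refl) =
    i , refl
  -- The arc is stored from `y` to `u`, so the same flip is applied once more to get back to `y`.
  adjacent⇒flip (record { colour = inj₂ i ; source = inj₁ v ; moves = refl } , inj₂ refl) =
    i , cong inj₁ (sym (flip-involutive i v))

  -- The end `y` is left arbitrary so that one induction serves twice: it shows that no walk leaves
  -- the cube, and it bounds distances from below.
  walk⇒hamming≤ : ∀ {u y m} → G.Walk (inj₁ u) y m → ∃[ v ] (y ≡ inj₁ v × hamming u v ≤ m)
  walk⇒hamming≤ {u} G.[] = u , refl , ≤-reflexive (hamming-refl u)
  walk⇒hamming≤ {u} (a G.∷ w) with adjacent⇒flip a
  ... | i , refl with walk⇒hamming≤ w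
  ... | v , refl , h = v , refl , ≤-trans (hamming-flip i u v) (s≤s h)

  -- The distance is generalised to `k` so that the recursion is structural.
  hamming-walk : ∀ u v k → hamming u v ≡ k → H.Walk (vertex u) (vertex v) k
  hamming-walk u v zero    eq with hamming≡0⇒≡ u v eq
  ... | refl = H.[]
  hamming-walk u v (suc k) eq with hamming-closer u v eq
  ... | i , eq′ = (flipEdge i u , inj₁ refl) H.∷ hamming-walk (flip i u) v k eq′

  hamming-distance : ∀ u v → H.Distance (vertex u) (vertex v) (hamming u v)
  hamming-distance u v = hamming-walk u v _ refl , λ m w → bound w
    where
    bound : ∀ {m} → H.Walk (vertex u) (vertex v) m → hamming u v ≤ m
    bound w with walk⇒hamming≤ (walk-value _ _ w)
    ... | _ , refl , h = h

  cube-isComponent : G.IsComponent IsVertex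
  cube-isComponent = inj₁ origin , reach , stay
    where
    origin : Cube n
    origin = replicate n false
    reach : ∀ {x} → IsVertex x → G.Connected (inj₁ origin) x
    reach {inj₁ v} _ = hamming origin v , walk-value _ _ (hamming-walk origin v _ refl)
    stay : ∀ {x} → G.Connected (inj₁ origin) x → IsVertex x
    stay (_ , w) with walk⇒hamming≤ w
    ... | _ , refl , _ = tt

  cube-hasDiameter : H.HasDiameter n
  cube-hasDiameter = distances , vertex (replicate n false) , vertex (replicate n true) ,
    subst (H.Distance _ _) (hamming-antipodal n) (hamming-distance _ _)
    where
    distances : ∀ x y → ∃[ m ] (H.Distance x y m × m ≤ n)
    distances (inj₁ u ,ʳ _) (inj₁ v ,ʳ _) = hamming u v , hamming-distance u v , hamming≤n u v
    distances (inj₂ _ ,ʳ Irrelevant.[ () ]) _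
    distances (inj₁ _ ,ʳ _) (inj₂ _ ,ʳ Irrelevant.[ () ])

  -- Cube vertices act trivially, so an edge of such a colour would be a loop.
  vertexColour-unused : ∀ u → H.edgesOfColour (inj₁ u) HasSize 0
  vertexColour-unused u = record
    { to        = λ e → ⊥-elim (noEdge e)
    ; from      = λ ()
    ; to-cong   = λ {e} → ⊥-elim (noEdge e)
    ; from-cong = λ { {()} }
    ; inverse   = (λ { {()} }) , λ {e} → ⊥-elim (noEdge e)
    }
    where
    noEdge : Σ H.Edge (λ e → H.colour e ≡ inj₁ u) → ⊥
    noEdge ((record { source = inj₁ _ ; distinct = d ; moves = m } ,ʳ _) , refl) = d m
    noEdge ((record { source = inj₂ _ ; distinct = d ; moves = m } ,ʳ _) , _)    = d m

-- Deleting coordinate i identifies the two ends of an edge in direction i,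
-- so it labels these edges by the vertices of the n-cube.
module _ {n : ℕ} (i : Fin (suc n)) where
  private
    module H = ColouredMultigraph (induced (keiGraph (cubeKei (suc n))) (IsVertex (suc n)))
    open Arc

    Edgeᵢ : Set
    Edgeᵢ = Σ H.Edge (λ e → H.colour e ≡ inj₂ i)

    -- Directions get a junk value; no edge ends at one.
    delete : Cube (suc n) ⊎ Fin (suc n) → Cube n
    delete = [ (λ u → removeAt u i) , const (replicate n false) ]

    delete-▷ : ∀ x → delete (_▷_ (suc n) x (inj₂ i)) ≡ delete x
    delete-▷ (inj₁ u) = removeAt-flip i u
    delete-▷ (inj₂ _) = refl

    to : Edgeᵢ → Cube n
    to ((a ,ʳ _) , _) = delete (source a)

    to-cong : (e e′ : Edgeᵢ) → proj₁ e H.≈ₑ proj₁ e′ → to e ≡ to e′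
    to-cong _ _ (_ , inj₁ eq) = cong (delete ∘ proj₁) eq
    to-cong ((a ,ʳ _) , _) ((b ,ʳ _) , refl) (_ , inj₂ eq) =
      -- Opposite orientations: the source of `a` is the target of `b`, which is the source of `b`
      -- flipped at `i`, and deletion does not see that flip.
      trans (cong (delete ∘ proj₁) eq)
        (trans (cong delete (sym (moves b))) (delete-▷ (source b)))

    from : Cube n → Edgeᵢ
    from w = flipEdge (suc n) i (insertAt w i false) , refl

    from∘to : ∀ e → proj₁ (from (to e)) H.≈ₑ proj₁ e
    from∘to ((record { source = inj₂ _ ; distinct = d ; moves = m } ,ʳ _) , _) =
      contradiction m d
    from∘to ((record { source = inj₁ u ; moves = refl } ,ʳ _) , refl)
      with insertAt-false-removeAt i u
    ... | inj₁ eq = refl , inj₁ (cong (λ v → inj₁ v , inj₁ (flip i v)) eq)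
    -- The rebuilt arc starts at the other end of the original, so it is the same edge reversed.
    ... | inj₂ eq = refl , inj₂ (cong₂ _,_ (cong inj₁ eq)
      (cong inj₁ (trans (cong (flip i) eq) (flip-involutive i u))))

    from-cong : ∀ {w w′} → w ≡ w′ → proj₁ (from w) H.≈ₑ proj₁ (from w′)
    from-cong refl = refl , inj₁ refl

  edgesOfDirection↔Cube : Inverse (H.edgesOfColour (inj₂ i)) (setoid (Cube n))
  edgesOfDirection↔Cube = record
    { to        = to
    ; from      = from
    ; to-cong   = λ {e} {e′} → to-cong e e′
    ; from-cong = from-cong
    ; inverse   =
        (λ {w} {e} e≈ → trans (to-cong e (from w) e≈) (removeAt-insertAt w i false))
      , (λ { {e} refl → from∘to e })
    }

  direction-hasSize : H.edgesOfColour (inj₂ i) HasSize (2 ^ n)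
  direction-hasSize = Composition.inverse edgesOfDirection↔Cube (Cube↔Fin n)

cube-maxColourClassSize : ∀ n →
  ColouredMultigraph.MaxColourClassSize
    (induced (keiGraph (cubeKei (suc n))) (IsVertex (suc n))) (2 ^ n)
cube-maxColourClassSize n =
    (λ { (inj₁ u) → 0 , vertexColour-unused (suc n) u , z≤n
       ; (inj₂ i) → 2 ^ n , direction-hasSize i , ≤-refl })
  -- A direction `zero` exists because the dimension is `suc n`.
  , inj₂ zero , direction-hasSize zero

mainTheorem2 : (d : ℕ) → 1 ≤ d →
    Σ Kei λ K →
    Finite (Kei.Carrier K) ×
    Σ (Pred (Kei.Carrier K) 0ℓ) λ C →
    ColouredMultigraph.IsComponent (keiGraph K) C ×
    ColouredMultigraph.HasDiameter (induced (keiGraph K) C) d ×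
    setoid (Refinement (Kei.Carrier K) C) HasSize (2 ^ d) ×
    ColouredMultigraph.MaxColourClassSize (induced (keiGraph K) C) (2 ^ (d ∸ 1))
-- `1 ≤ d` excludes zero, and for `suc n` the exponent `d ∸ 1` computes to `n`.
mainTheorem2 d@(suc n) _ =
    cubeKei d
  , cubeKei-finite d
  , IsVertex d
  , cube-isComponent d
  , cube-hasDiameter d
  , ↔-trans (Vertex↔Cube d) (Cube↔Fin d)
  , cube-maxColourClassSize n
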